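{- There exists $n_0$ such that for every integer $n \ge n_0$ the following holds: for any (deterministic, adaptive) strategy of the codebreaker in the Permutation Variant of Mastermind on $[n]=\{1,\dots,n\}$, the codebreaker must use at least $n - \log\log n$ guesses to determine the hidden permutation $H$ in the worst case. That is, $f(n) \ge n - \log\log n$ for all sufficiently large $n$.
   Context: Permutation Variant of Mastermind: the codemaker fixes a hidden permutation $H=(h_1,\dots,h_n)$ of $[n]$. In each turn $t=1,2,\dots$ the codebreaker submits a guess $Q_t=(q_1,\dots,q_n)$, which must also be a permutation of $[n]$, and receives the black-peg response $b(Q_t,H)=|\{i\in\{1,\dots,n\} : q_i=h_i\}|$. The game is adaptive: $Q_t$ may depend on the responses to $Q_1,\dots,Q_{t-1}$. A deterministic strategy is a rule which specifies each guess $Q_t$ as a function of the previous guesses and the responses received. For a fixed strategy and hidden permutation $H$, let $S_t$ be the set of permutations $h$ of $[n]$ with $b(Q_i,h)=b(Q_i,H)$ for all $1\le i\le t$ (with $S_0$ the set of all permutations of $[n]$). The codebreaker has determined $H$ after $t$ guesses exactly when $|S_t|=1$. The number $f(n)$ is the smallest integer $m$ for which there is a deterministic strategy that, for every hidden permutation $H$, has determined $H$ after at most $m$ guesses. Here $\log$ denotes the natural logarithm. -}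

module Defs where

open import Algebra.Definitions.RawSemiring using (_^_)
open import Data.Fin.Permutation using (Permutation′; _⟨$⟩ʳ_; _≈_)
import Data.Fin.Properties as Fin
open import Data.Fin.Subset using (Subset; ∣_∣)
open import Data.Integer.Base using (+_)
open import Data.List.Base using (List; []; _∷_)
open import Data.Nat.Base as ℕ using (ℕ; zero; suc)
open import Data.Product using (_×_; _,_; ∃-syntax; ∃!)
open import Data.Rational.Base as ℚ using (ℚ)
open import Data.Vec.Base using (tabulate)
open import Relation.Binary.PropositionalEquality using (_≡_)
open import Relation.Nullary using (¬_; does)

------------------------------------------------------------------------
-- Permutation Mastermind

coincidences : ∀ {n} → Permutation′ n → Permutation′ n → Subset n
coincidences Q H = tabulate λ i → does ((Q ⟨$⟩ʳ i) Fin.≟ (H ⟨$⟩ʳ i))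

blackPegs : ∀ {n} → Permutation′ n → Permutation′ n → ℕ
blackPegs Q H = ∣ coincidences Q H ∣

-- Past guesses with the responses received, most recent first.
History : ℕ → Set
History n = List (Permutation′ n × ℕ)

Strategy : ℕ → Set
Strategy n = History n → Permutation′ n

module _ {n : ℕ} (σ : Strategy n) (H : Permutation′ n) where

  history : ℕ → History n
  history zero    = []
  history (suc t) = (Q , blackPegs Q H) ∷ history t
    where Q = σ (history t)

  -- Indexed from zero: guess t is the guess Q_{t+1}.
  guess : ℕ → Permutation′ n
  guess t = σ (history t)

  -- h lies in S_t.
  Consistent : ℕ → Permutation′ n → Set
  Consistent t h = ∀ i → i ℕ.< t → blackPegs (guess i) h ≡ blackPegs (guess i) H

  -- |S_t| = 1; permutations are compared as functions.
  Determined : ℕ → Set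
  Determined t = ∃! _≈_ (Consistent t)

DeterminesWithin : ∀ {n} → Strategy n → ℕ → Set
DeterminesWithin {n} σ m = ∀ (H : Permutation′ n) → ∃[ t ] t ℕ.≤ m × Determined σ H t

-- The graph of f: IsOptimal n m says that f(n) = m.
IsOptimal : ℕ → ℕ → Set
IsOptimal n m = (∃[ σ ] DeterminesWithin {n} σ m)
              × (∀ k → (∃[ σ ] DeterminesWithin {n} σ k) → m ℕ.≤ k)

------------------------------------------------------------------------
-- Real numbers as pairs of cuts

-- A real x is given by Lower q ⇔ q < x and Upper q ⇔ x < q.  The Dedekind
-- axioms are not fields of the record; the operations below are the usual
-- ones and yield Dedekind cuts where the corresponding real is defined
-- (log x is used for x > 0 only; for x ≤ 0 the construction gives −∞).
record Real : Set₁ where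
  field
    Lower : ℚ → Set
    Upper : ℚ → Set
open Real public

infix  4 _<ᴿ_ _≤ᴿ_
infixl 6 _-ᴿ_

_<ᴿ_ : Real → Real → Set
x <ᴿ y = ∃[ q ] Upper x q × Lower y q

_≤ᴿ_ : Real → Real → Set
x ≤ᴿ y = ¬ (y <ᴿ x)

fromℚ : ℚ → Real
fromℚ p = record { Lower = λ q → q ℚ.< p ; Upper = λ q → p ℚ.< q }

fromℕ : ℕ → Real
fromℕ n = fromℚ (+ n ℚ./ 1)

_-ᴿ_ : Real → Real → Real
x -ᴿ y = record
  { Lower = λ q → ∃[ r ] ∃[ s ] Lower x r × Upper y s × q ≡ r ℚ.- s
  ; Upper = λ q → ∃[ r ] ∃[ s ] Upper x r × Lower y s × q ≡ r ℚ.- s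
  }

-- The limit of a convergent sequence: q < lim a iff, for some s > q, the terms
-- are eventually ≥ s; dually for lim a < q.
lim : (ℕ → ℚ) → Real
lim a = record
  { Lower = λ q → ∃[ s ] q ℚ.< s × ∃[ N ] (∀ k → N ℕ.≤ k → s ℚ.≤ a k)
  ; Upper = λ q → ∃[ s ] s ℚ.< q × ∃[ N ] (∀ k → N ℕ.≤ k → a k ℚ.≤ s)
  }

-- Euler's limit e^q = lim (1 + q/k)^k, the index being shifted so that k ≥ 1.
exp : ℚ → Real
exp q = lim λ k → (ℚ.1ℚ ℚ.+ q ℚ.* (+ 1 ℚ./ suc k)) ^ℚ suc k
  where _^ℚ_ = _^_ ℚ.+-*-rawSemiring

-- The natural logarithm, as the inverse of exp: q < log x iff e^q < x, and
-- log x < q iff x < e^q.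
log : Real → Real
log x = record
  { Lower = λ q → exp q <ᴿ x
  ; Upper = λ q → x <ᴿ exp q
  }

{-# OPTIONS --safe #-}
module Submission where

open import Defs
open import Data.Nat.Base using (ℕ; _≤_)
open import Data.Product using (_×_; ∃-syntax)
open import Algebra.Bundles using (CommutativeMonoid; CommutativeRing)
open import Data.Bool.Base using (Bool; true; false; if_then_else_)
open import Data.Fin.Base using (Fin; zero; suc; toℕ; fromℕ<; punchIn; punchOut)
open import Data.Fin.Permutation using (Permutation′; _⟨$⟩ʳ_; _≈_; id; remove; insert; insert-punchIn; punchIn-permute)
import Data.Fin.Properties as Fin
open import Data.Fin.Subset using (∣_∣)
open import Data.Fin.Subset.Properties using (x∈p⇒∣p-x∣<∣p∣)
import Data.Integer.Base as ℤ
import Data.Integer.Properties as ℤ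
open import Data.List.Base using (List; []; _∷_; [_]; length; map; filter; allFin; cartesianProductWith)
open import Data.List.Properties using (length-map; length-++; length-tabulate; ∷-injective)
open import Data.List.Relation.Binary.Sublist.Propositional.Properties as Sublist using (length-mono-≤; filter-⊆)
open import Data.List.Relation.Unary.All as All using (All; []; _∷_)
open import Data.List.Relation.Unary.All.Properties as All using (all-filter)
open import Data.List.Relation.Unary.AllPairs using ([]; _∷_)
import Data.List.Relation.Unary.Unique.Propositional.Properties as Uniqueₚ
open import Data.List.Relation.Unary.Unique.Setoid using (Unique)
import Data.List.Relation.Unary.Unique.Setoid.Properties as Unique
open import Data.Nat.Base hiding (_≤_; ℕ)
open import Data.Nat.DivMod using (_/_; m*n/n≡m; /-monoˡ-≤; m/n*n≤m; n/1≡n; /-monoʳ-≤)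
open import Data.Nat.Properties
open import Data.Nat.Solver using (module +-*-Solver)
open import Data.Product using (_,_; proj₁; proj₂)
open import Data.Rational.Base as ℚ using (ℚ; 0ℚ; 1ℚ; toℚᵘ)
import Data.Rational.Properties as ℚ
import Data.Rational.Unnormalised.Base as ℚᵘ
import Data.Rational.Unnormalised.Properties as ℚᵘ
open import Data.Sum.Base using (inj₁; inj₂)
open import Data.Vec.Base using (tabulate)
open import Data.Vec.Properties using (lookup⇒[]=; lookup∘tabulate)
open import Function.Base using (_∘_)
open import Function.Bundles using (mk⇔)
open import Level using (0ℓ)
open import Relation.Binary.Bundles using (Setoid)
open import Relation.Binary.PropositionalEquality hiding ([_])
open import Relation.Nullary using (¬_; does; yes; no; contradiction)
open import Relation.Nullary.Decidable using (does-⇔; dec-true; ¬?)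
open import Relation.Unary using (Decidable)
open import Algebra.Properties.CommutativeMonoid.Sum +-0-commutativeMonoid
  using (sum; sum-remove; sum-cong-≗; ∑-distrib-+)
open import Algebra.Properties.CommutativeSemigroup *-commutativeSemigroup using (x∙yz≈y∙xz)
open import Algebra.Properties.CommutativeSemigroup
  (CommutativeMonoid.commutativeSemigroup ℚ.*-1-commutativeMonoid)
  using () renaming (x∙yz≈y∙xz to ℚ-x∙yz≈y∙xz; xy∙z≈xz∙y to ℚ-xy∙z≈xz∙y)
open import Algebra.Properties.CommutativeSemiring.Exp
  (CommutativeRing.commutativeSemiring ℚ.+-*-commutativeRing)
  using () renaming (_^_ to _^ℚ_; ^-distrib-* to ^ℚ-distrib-*)

-- The codemaker keeps a large set S of hidden permutations compatible with its answers.
-- At most n!/j! permutations agree with a given guess in j or more places, so one of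
-- the answers 0, …, j − 1 keeps at least (|S| − n!/j!)/j of them.  With j = t + L + 1 in
-- round t and L = n − m, |S| (t + L)! starts at n! L! and loses at most n!/j per round,
-- hence |S| ≥ L! − (1/1 + … + 1/n) after m rounds.  If the codebreaker needs m < n − log log n
-- guesses only, then n < e^(e^L) < 4^(4^L), so the harmonic sum is at most 1 + 2·4^L,
-- which for L ≥ 10 is too small to bring |S| down to 1.

-- Double counting in lists.

bit : Bool → ℕ
bit b = if b then 1 else 0

∣tabulate∣≡sum : ∀ {k} (b : Fin k → Bool) → ∣ tabulate b ∣ ≡ sum (bit ∘ b)
∣tabulate∣≡sum {zero}  b = refl
∣tabulate∣≡sum {suc k} b with b zero
... | true  = cong suc (∣tabulate∣≡sum (b ∘ suc))
... | false = ∣tabulate∣≡sum (b ∘ suc)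

sum*e≤k*d : ∀ {k} d e (g : Fin k → ℕ) → (∀ i → g i * e ≤ d) → sum g * e ≤ k * d
sum*e≤k*d {zero}  d e g g≤ = z≤n
sum*e≤k*d {suc k} d e g g≤ = begin
  (g zero + sum (g ∘ suc)) * e    ≡⟨ *-distribʳ-+ e (g zero) _ ⟩
  g zero * e + sum (g ∘ suc) * e  ≤⟨ +-mono-≤ (g≤ zero) (sum*e≤k*d d e (g ∘ suc) (g≤ ∘ suc)) ⟩
  d + k * d                       ∎
  where open ≤-Reasoning

argmax : ∀ {k} (g : Fin (suc k) → ℕ) → ∃[ i ] ∀ j → g j ≤ g i
argmax {zero}  g = zero , λ { zero → ≤-refl }
argmax {suc k} g with argmax (g ∘ suc)
... | i , max with g zero ≤? g (suc i)
...   | yes le = suc i , λ { zero → le ; (suc j) → max j }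
...   | no  gt = zero , λ { zero → ≤-refl ; (suc j) → ≤-trans (max j) (<⇒≤ (≰⇒> gt)) }

module _ {A : Set} where

  length-filter-∷ : ∀ {P : A → Set} (P? : Decidable P) x xs →
    length (filter P? (x ∷ xs)) ≡ bit (does (P? x)) + length (filter P? xs)
  length-filter-∷ P? x xs with does (P? x)
  ... | true  = refl
  ... | false = refl

  length-filter-∁ : ∀ {P : A → Set} (P? : Decidable P) xs →
    length xs ≡ length (filter P? xs) + length (filter (¬? ∘ P?) xs)
  length-filter-∁ P? []       = refl
  length-filter-∁ P? (x ∷ xs) with does (P? x)
  ... | true  = cong suc (length-filter-∁ P? xs)
  ... | false = trans (cong suc (length-filter-∁ P? xs)) (sym (+-suc _ _))

  module _ {k} {R : Fin k → A → Set} (R? : ∀ i → Decidable (R i)) where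

    -- Phrased through a tabulated subset so that, for the relation "Q and x agree at i", it unfolds
    -- to `blackPegs Q x`.
    incidence : A → ℕ
    incidence x = ∣ tabulate (λ i → does (R? i x)) ∣

    incidence-pos : ∀ {x} i → R i x → 1 ≤ incidence x
    incidence-pos {x} i r = ≤-trans (s≤s z≤n) (x∈p⇒∣p-x∣<∣p∣ i∈p)
      where
      p = tabulate (λ i → does (R? i x))
      i∈p = lookup⇒[]= i p (trans (lookup∘tabulate _ i) (dec-true (R? i x) r))

    double-counting : ∀ {c} xs → All (λ x → c ≤ incidence x) xs →
      length xs * c ≤ sum (λ i → length (filter (R? i) xs))
    double-counting []       []          = z≤n
    double-counting {c} (x ∷ xs) (c≤x ∷ c≤xs) = begin
      c + length xs * c
        ≤⟨ +-mono-≤ c≤x (double-counting xs c≤xs) ⟩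
      incidence x + sum (λ i → length (filter (R? i) xs))
        ≡⟨ cong (_+ _) (∣tabulate∣≡sum (λ i → does (R? i x))) ⟩
      sum (λ i → bit (does (R? i x))) + sum (λ i → length (filter (R? i) xs))
        ≡⟨ ∑-distrib-+ (λ i → bit (does (R? i x))) (λ i → length (filter (R? i) xs)) ⟨
      sum (λ i → bit (does (R? i x)) + length (filter (R? i) xs))
        ≡⟨ sum-cong-≗ (λ i → length-filter-∷ (R? i) x xs) ⟨
      sum (λ i → length (filter (R? i) (x ∷ xs))) ∎
      where open ≤-Reasoning

    -- The factor `e` lets a bound d/e on each class be used without division; below, d/e is n!/j!.
    length*c*e≤k*d : ∀ {c} d e xs → All (λ x → c ≤ incidence x) xs →
      (∀ i → length (filter (R? i) xs) * e ≤ d) → length xs * c * e ≤ k * d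
    length*c*e≤k*d d e xs c≤ ≤d =
      ≤-trans (*-monoˡ-≤ e (double-counting xs c≤)) (sum*e≤k*d d e _ ≤d)

-- Counting permutations that agree with a guess in many places.

≈-setoid : ℕ → Setoid 0ℓ 0ℓ
≈-setoid n = record
  { Carrier       = Permutation′ n
  ; _≈_           = _≈_
  ; isEquivalence = record
    { refl  = λ _ → refl
    ; sym   = λ p i → sym (p i)
    ; trans = λ p q i → trans (p i) (q i)
    }
  }

Distinct : ∀ {n} → List (Permutation′ n) → Set
Distinct = Unique (≈-setoid _)

remove-injective : ∀ {n} i (x y : Permutation′ (suc n)) →
  x ⟨$⟩ʳ i ≡ y ⟨$⟩ʳ i → remove i x ≈ remove i y → x ≈ y
remove-injective i x y xi≡yi x≈y j with i Fin.≟ j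
... | yes refl = xi≡yi
... | no  i≢j = begin
  x ⟨$⟩ʳ j                                ≡⟨ cong (x ⟨$⟩ʳ_) (Fin.punchIn-punchOut i≢j) ⟨
  x ⟨$⟩ʳ punchIn i k                      ≡⟨ punchIn-permute x i k ⟩
  punchIn (x ⟨$⟩ʳ i) (remove i x ⟨$⟩ʳ k)  ≡⟨ cong₂ punchIn xi≡yi (x≈y k) ⟩
  punchIn (y ⟨$⟩ʳ i) (remove i y ⟨$⟩ʳ k)  ≡⟨ punchIn-permute y i k ⟨
  y ⟨$⟩ʳ punchIn i k                      ≡⟨ cong (y ⟨$⟩ʳ_) (Fin.punchIn-punchOut i≢j) ⟩
  y ⟨$⟩ʳ j                                ∎
  where
  open ≡-Reasoning
  k = punchOut i≢j

map-remove-distinct : ∀ {n} i {xs : List (Permutation′ (suc n))} v →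
  All (λ x → v ≡ x ⟨$⟩ʳ i) xs → Distinct xs → Distinct (map (remove i) xs)
map-remove-distinct i v []         []         = []
map-remove-distinct i {x ∷ _} v (px ∷ pxs) (x∉ ∷ xs!) =
  All.map⁺ (All.zipWith (λ {y} (v≡yi , x≉y) x≈y →
    x≉y (remove-injective i x y (trans (sym px) v≡yi) x≈y)) (pxs , x∉))
  ∷ map-remove-distinct i v pxs xs!

-- Position i contributes one peg. Elsewhere both values are relabelled by `punchIn` at the same
-- removed value, which is injective, so agreement is neither gained nor lost.
blackPegs-remove : ∀ {n} i (Q x : Permutation′ (suc n)) → Q ⟨$⟩ʳ i ≡ x ⟨$⟩ʳ i →
  blackPegs Q x ≡ suc (blackPegs (remove i Q) (remove i x))
blackPegs-remove i Q x Qi≡xi = begin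
  blackPegs Q x      ≡⟨ ∣tabulate∣≡sum agree ⟩
  sum (bit ∘ agree)  ≡⟨ sum-remove {i = i} (bit ∘ agree) ⟩
  bit (agree i) + sum (λ j → bit (agree (punchIn i j)))
    ≡⟨ cong₂ _+_ (cong bit (dec-true (_ Fin.≟ _) Qi≡xi)) (sum-cong-≗ (cong bit ∘ agree-punchIn)) ⟩
  suc (sum (bit ∘ agree′))                   ≡⟨ cong suc (∣tabulate∣≡sum agree′) ⟨
  suc (blackPegs (remove i Q) (remove i x))  ∎
  where
  open ≡-Reasoning
  agree  = λ j → does ((Q ⟨$⟩ʳ j) Fin.≟ (x ⟨$⟩ʳ j))
  agree′ = λ j → does ((remove i Q ⟨$⟩ʳ j) Fin.≟ (remove i x ⟨$⟩ʳ j))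
  agree-punchIn : ∀ j → agree (punchIn i j) ≡ agree′ j
  agree-punchIn j = does-⇔ (mk⇔
    (λ eq → Fin.punchIn-injective (x ⟨$⟩ʳ i) _ _ (begin
      punchIn (x ⟨$⟩ʳ i) (remove i Q ⟨$⟩ʳ j)  ≡⟨ cong (λ v → punchIn v _) Qi≡xi ⟨
      punchIn (Q ⟨$⟩ʳ i) (remove i Q ⟨$⟩ʳ j)  ≡⟨ punchIn-permute Q i j ⟨
      Q ⟨$⟩ʳ punchIn i j                      ≡⟨ eq ⟩
      x ⟨$⟩ʳ punchIn i j                      ≡⟨ punchIn-permute x i j ⟩
      punchIn (x ⟨$⟩ʳ i) (remove i x ⟨$⟩ʳ j)  ∎))
    (λ eq → trans (punchIn-permute Q i j)
      (trans (cong₂ punchIn Qi≡xi eq) (sym (punchIn-permute x i j)))))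
    (_ Fin.≟ _) (_ Fin.≟ _)

-- Induction on n, counting the pairs of an x in `xs` and a place where x agrees with Q. Each x lies
-- in at least j such pairs. The x agreeing with Q at i stay distinct when i is removed and still
-- agree with `remove i Q` in j - 1 places, so each of the n places has at most (n - 1)!/(j - 1)! of
-- them.
length*j!≤n! : ∀ n j (Q : Permutation′ n) xs → Distinct xs →
  All (λ x → j ≤ blackPegs Q x) xs → length xs * j ! ≤ n !
length*j!≤n! zero j       Q []           _               _         = z≤n
length*j!≤n! zero zero    Q (x ∷ [])     _               _         = ≤-refl
length*j!≤n! zero (suc _) Q (x ∷ [])     _               (() ∷ _)
length*j!≤n! zero j       Q (x ∷ y ∷ xs) ((x≉y ∷ _) ∷ _) _         = contradiction (λ ()) x≉y
-- For j = 0 counting agreements gives nothing, so the list is split by the value at `zero`. The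
-- guess passed on is arbitrary, hence `id`.
length*j!≤n! (suc n) zero Q xs xs! _ =
  subst (_≤ suc n !) (*-identityʳ _) (length*c*e≤k*d R? (n !) 1 xs
    (All.universal (λ x → incidence-pos R? {x} (x ⟨$⟩ʳ zero) refl) xs) λ v →
    let ys = filter (R? v) xs
    in subst (λ l → l * 1 ≤ n !) (length-map (remove zero) ys)
         (length*j!≤n! n 0 id (map (remove zero) ys)
           (map-remove-distinct zero v (all-filter (R? v) xs) (Unique.filter⁺ (≈-setoid _) (R? v) xs!))
           (All.universal (λ _ → z≤n) _)))
  where
  R? = λ v (x : Permutation′ (suc n)) → v Fin.≟ (x ⟨$⟩ʳ zero)
length*j!≤n! (suc n) (suc j) Q xs xs! j≤ =
  subst (_≤ suc n !) (*-assoc (length xs) (suc j) (j !))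
    (length*c*e≤k*d R? (n !) (j !) xs j≤ λ i →
      let ys = filter (R? i) xs
      in subst (λ l → l * j ! ≤ n !) (length-map (remove i) ys)
           (length*j!≤n! n j (remove i Q) (map (remove i) ys)
             (map-remove-distinct i (Q ⟨$⟩ʳ i) (all-filter (R? i) xs) (Unique.filter⁺ (≈-setoid _) (R? i) xs!))
             (All.map⁺ (All.zipWith (λ {x} (Qi≡xi , j<) →
                 s≤s⁻¹ (subst (suc j ≤_) (blackPegs-remove i Q x Qi≡xi) j<))
               (all-filter (R? i) xs , All.filter⁺ (R? i) j≤)))))
  where
  R? = λ i (x : Permutation′ (suc n)) → (Q ⟨$⟩ʳ i) Fin.≟ (x ⟨$⟩ʳ i)

-- The initial list of n! candidates.

permutations : ∀ n → List (Permutation′ n)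
permutations zero    = [ id ]
permutations (suc n) = cartesianProductWith (insert zero) (allFin (suc n)) (permutations n)

insert-injective : ∀ {n} {v w : Fin (suc n)} {x y : Permutation′ n} →
  insert zero v x ≈ insert zero w y → v ≡ w × x ≈ y
insert-injective {v = v} {w} {x} {y} eq = eq zero , λ k → Fin.punchIn-injective v _ _ (begin
  punchIn v (x ⟨$⟩ʳ k)        ≡⟨ insert-punchIn zero v x k ⟨
  insert zero v x ⟨$⟩ʳ suc k  ≡⟨ eq (suc k) ⟩
  insert zero w y ⟨$⟩ʳ suc k  ≡⟨ insert-punchIn zero w y k ⟩
  punchIn w (y ⟨$⟩ʳ k)        ≡⟨ cong (λ u → punchIn u _) (eq zero) ⟨
  punchIn v (y ⟨$⟩ʳ k)        ∎)
  where open ≡-Reasoning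

permutations-distinct : ∀ n → Distinct (permutations n)
permutations-distinct zero    = [] ∷ []
permutations-distinct (suc n) =
  Unique.cartesianProductWith⁺ (setoid _) (≈-setoid n) (≈-setoid (suc n)) (insert zero)
    insert-injective (Uniqueₚ.allFin⁺ (suc n)) (permutations-distinct n)

length-cartesianProductWith : ∀ {A B C : Set} (f : A → B → C) xs ys →
  length (cartesianProductWith f xs ys) ≡ length xs * length ys
length-cartesianProductWith f []       ys = refl
length-cartesianProductWith f (x ∷ xs) ys =
  trans (length-++ (map (f x) ys))
    (cong₂ _+_ (length-map (f x) ys) (length-cartesianProductWith f xs ys))

length-permutations : ∀ n → length (permutations n) ≡ n !
length-permutations zero    = refl
length-permutations (suc n) =
  trans (length-cartesianProductWith (insert zero) (allFin (suc n)) (permutations n))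
    (cong₂ _*_ (length-tabulate {n = suc n} (λ i → i)) (length-permutations n))

-- The codemaker's choice of answer and what a history reveals.

-- The elements with f x ≤ p fall into p + 1 classes, and the largest class has at least the average
-- size; the others are written off. For responses, `k` is the codemaker's answer.
pigeonhole : ∀ {A : Set} (f : A → ℕ) p xs → ∃[ k ]
  length xs ≤ suc p * length (filter (λ x → f x ≟ k) xs) + length (filter (λ x → suc p ≤? f x) xs)
pigeonhole f p xs = toℕ k , (begin
  length xs                                                      ≡⟨ length-filter-∁ (λ x → suc p ≤? f x) xs ⟩
  length large + length small                                    ≡⟨ +-comm (length large) _ ⟩
  length small + length large                                    ≤⟨ +-monoˡ-≤ (length large) small≤ ⟩
  suc p * count k + length large                                 ≤⟨ +-monoˡ-≤ (length large) (*-monoʳ-≤ (suc p) (filter-mono k)) ⟩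
  suc p * length (filter (λ x → f x ≟ toℕ k) xs) + length large  ∎)
  where
  open ≤-Reasoning
  large = filter (λ x → suc p ≤? f x) xs
  small = filter (λ x → ¬? (suc p ≤? f x)) xs
  R? = λ (k : Fin (suc p)) x → f x ≟ toℕ k
  count = λ k → length (filter (R? k) small)
  k = proj₁ (argmax count)
  filter-mono : ∀ k → count k ≤ length (filter (R? k) xs)
  filter-mono k = length-mono-≤ (Sublist.filter⁺ (R? k) (R? k) (λ { refl p → p }) (filter-⊆ _ xs))
  small≤ : length small ≤ suc p * count k
  small≤ = subst (_≤ suc p * count k) (trans (*-identityʳ _) (*-identityʳ _))
    (length*c*e≤k*d R? (count k) 1 small
      (All.map (λ {x} sp≰fx → incidence-pos R? {x} (fromℕ< (≰⇒> sp≰fx)) (sym (Fin.toℕ-fromℕ< _)))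
        (all-filter (λ x → ¬? (suc p ≤? f x)) xs))
      (λ i → subst (_≤ count k) (sym (*-identityʳ _)) (proj₂ (argmax count) i)))

-- A strategy sees only the history, so equal histories mean equal guesses, and the recorded
-- responses are then responses to the same guess.
history-≡⇒consistent : ∀ {n} (σ : Strategy n) x y t →
  history σ x t ≡ history σ y t → Consistent σ x t y
history-≡⇒consistent σ x y (suc t) eq i i<1+t with ∷-injective eq | m≤n⇒m<n∨m≡n (s≤s⁻¹ i<1+t)
... | _     , hist≡ | inj₁ i<t  = history-≡⇒consistent σ x y t hist≡ i i<t
... | turn≡ , hist≡ | inj₂ refl =
  trans (cong (λ h → blackPegs (σ h) y) hist≡) (sym (cong proj₂ turn≡))

-- Harmonic sums scaled to integers.

-- N times the p-th harmonic number, with each term rounded down. For N = n! and p ≤ n every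
-- division is exact.
harmonic : ℕ → ℕ → ℕ
harmonic N zero    = 0
harmonic N (suc p) = harmonic N p + N / suc p

harmonic-mono : ∀ N {p q} → p ≤ q → harmonic N p ≤ harmonic N q
harmonic-mono N {p} {q} p≤q = go (≤⇒≤′ p≤q)
  where
  go : ∀ {q} → p ≤′ q → harmonic N p ≤ harmonic N q
  go ≤′-refl       = ≤-refl
  go (≤′-step p≤q) = ≤-trans (go p≤q) (m≤m+n _ _)

harmonic-+ : ∀ N p .{{_ : NonZero p}} r → harmonic N (r + p) ≤ harmonic N p + r * (N / p)
harmonic-+ N p zero    = ≤-reflexive (sym (+-identityʳ _))
harmonic-+ N p (suc r) = begin
  harmonic N (r + p) + N / suc (r + p)  ≤⟨ +-mono-≤ (harmonic-+ N p r) (/-monoʳ-≤ N (m≤n⇒m≤1+n (m≤n+m p r))) ⟩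
  harmonic N p + r * (N / p) + N / p    ≡⟨ +-assoc (harmonic N p) _ _ ⟩
  harmonic N p + (r * (N / p) + N / p)  ≡⟨ cong (harmonic N p +_) (+-comm _ (N / p)) ⟩
  harmonic N p + suc r * (N / p)        ∎
  where open ≤-Reasoning

-- Dyadic blocks: the 2^k terms after the term N/2^k are each at most N/2^k, so every block adds at
-- most N.
harmonic-2^ : ∀ N k → harmonic N (2 ^ k) ≤ suc k * N
harmonic-2^ N zero    = ≤-reflexive (trans (n/1≡n N) (sym (+-identityʳ N)))
harmonic-2^ N (suc k) = begin
  harmonic N (2 ^ k + (2 ^ k + 0))          ≡⟨ cong (λ q → harmonic N (2 ^ k + q)) (+-identityʳ _) ⟩
  harmonic N (2 ^ k + 2 ^ k)                ≤⟨ harmonic-+ N (2 ^ k) (2 ^ k) ⟩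
  harmonic N (2 ^ k) + 2 ^ k * (N / 2 ^ k)  ≡⟨ cong (harmonic N (2 ^ k) +_) (*-comm (2 ^ k) _) ⟩
  harmonic N (2 ^ k) + N / 2 ^ k * 2 ^ k    ≤⟨ +-mono-≤ (harmonic-2^ N k) (m/n*n≤m N (2 ^ k)) ⟩
  suc k * N + N                             ≡⟨ +-comm _ N ⟩
  suc (suc k) * N                           ∎
  where
  open ≤-Reasoning
  instance _ = m^n≢0 2 k

-- The adversary argument.

pigeonhole-scaled : ∀ {N a b r} p → a ≤ suc p * b + r → r * suc p ! ≤ N →
  a * p ! ≤ b * suc p ! + N / suc p
pigeonhole-scaled {N} {a} {b} {r} p a≤ r≤ = begin
  a * p !                    ≤⟨ *-monoˡ-≤ (p !) a≤ ⟩
  (suc p * b + r) * p !      ≡⟨ *-distribʳ-+ (p !) (suc p * b) r ⟩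
  suc p * b * p ! + r * p !  ≡⟨ cong (λ z → z * p ! + r * p !) (*-comm (suc p) b) ⟩
  b * suc p * p ! + r * p !  ≡⟨ cong (_+ r * p !) (*-assoc b (suc p) (p !)) ⟩
  -- Writing r p! as r (p + 1)! / (p + 1) lets the bound on r (p + 1)! act under the floor.
  b * suc p ! + r * p !      ≡⟨ cong (b * suc p ! +_) (m*n/n≡m (r * p !) (suc p)) ⟨
  b * suc p ! + r * p ! * suc p / suc p
    ≡⟨ cong (λ z → b * suc p ! + z / suc p) (trans (*-assoc r (p !) (suc p)) (cong (r *_) (*-comm (p !) (suc p)))) ⟩
  b * suc p ! + r * suc p ! / suc p  ≤⟨ +-monoʳ-≤ (b * suc p !) (/-monoˡ-≤ (suc p) r≤) ⟩
  b * suc p ! + N / suc p            ∎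
  where open ≤-Reasoning

-- The members of `xs` share one history, so the codebreaker cannot tell them apart. The potential
-- is `length xs * (t + L) !`; its losses appear as harmonic sums added on both sides, which avoids
-- subtraction. The offset L makes the factorial reach n! after n - L rounds.
survivors : ∀ {n} (σ : Strategy n) L t → ∃[ hs ] ∃[ xs ]
  Distinct xs × All (λ x → history σ x t ≡ hs) xs ×
  n ! * L ! + harmonic (n !) L ≤ length xs * (t + L) ! + harmonic (n !) (t + L)
survivors {n} σ L zero = [] , permutations n , permutations-distinct n , All.universal (λ _ → refl) _ ,
  ≤-reflexive (cong (λ l → l * L ! + harmonic (n !) L) (sym (length-permutations n)))
survivors {n} σ L (suc t)
  with hs , xs , xs! , xs-hist , bound ← survivors σ L t
  with k , few-large ← pigeonhole (blackPegs (σ hs)) (t + L) xs =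
  (σ hs , k) ∷ hs , ys , Unique.filter⁺ (≈-setoid n) has-k? xs! , ys-hist , (begin
    n ! * L ! + harmonic (n !) L                            ≤⟨ bound ⟩
    length xs * p ! + harmonic (n !) p                      ≤⟨ +-monoˡ-≤ (harmonic (n !) p) (pigeonhole-scaled {b = length ys} {length (filter large? xs)} p few-large large≤) ⟩
    length ys * suc p ! + n ! / suc p + harmonic (n !) p    ≡⟨ +-assoc (length ys * suc p !) _ _ ⟩
    length ys * suc p ! + (n ! / suc p + harmonic (n !) p)  ≡⟨ cong (length ys * suc p ! +_) (+-comm (n ! / suc p) _) ⟩
    length ys * suc p ! + harmonic (n !) (suc p)            ∎)
  where
  open ≤-Reasoning
  p = t + L
  has-k? = λ x → blackPegs (σ hs) x ≟ k
  large? = λ x → suc p ≤? blackPegs (σ hs) x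
  ys = filter has-k? xs
  ys-hist : All (λ y → history σ y (suc t) ≡ (σ hs , k) ∷ hs) ys
  ys-hist = All.zipWith
    (λ {y} (hist≡ , b≡k) → trans (cong (λ h → (σ h , blackPegs (σ h) y) ∷ h) hist≡)
                              (cong (λ b → (σ hs , b) ∷ hs) b≡k))
    (All.filter⁺ has-k? xs-hist , all-filter has-k? xs)
  large≤ : length (filter large? xs) * suc p ! ≤ n !
  large≤ = length*j!≤n! n (suc p) (σ hs) _ (Unique.filter⁺ (≈-setoid n) large? xs!) (all-filter large? xs)

-- Two distinct permutations with the same history up to m are both consistent at every earlier
-- time, so neither could have been singled out.
determines⇒length≤1 : ∀ {n} (σ : Strategy n) {m hs} → DeterminesWithin σ m → ∀ xs →
  Distinct xs → All (λ x → history σ x m ≡ hs) xs → length xs ≤ 1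
determines⇒length≤1 σ det []       _ _ = z≤n
determines⇒length≤1 σ det (x ∷ []) _ _ = ≤-refl
determines⇒length≤1 σ {m} det (x ∷ y ∷ xs) ((x≉y ∷ _) ∷ _) (hx ∷ hy ∷ _)
  with t , t≤m , z , _ , unique ← det x =
  contradiction (λ i → trans (sym (unique {x} (λ i _ → refl) i)) (unique {y} cons-y i)) x≉y
  where
  cons-y : Consistent σ x t y
  cons-y i i<t = history-≡⇒consistent σ x y m (trans hx (sym hy)) i (<-≤-trans i<t t≤m)

-- As m + L = n, every term carries a factor n!, which cancels. What remains is 1 for the last
-- survivor and k + 1 for the harmonic sum up to 2^k.
determines⇒L!≤k+2 : ∀ {n} (σ : Strategy n) {m} L k → m + L ≡ n → n ≤ 2 ^ k →
  DeterminesWithin σ m → L ! ≤ 2 + k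
determines⇒L!≤k+2 {n} σ {m} L k refl n≤2^k det
  with hs , xs , xs! , xs-hist , bound ← survivors σ L m =
  *-cancelˡ-≤ (n !) {{n !≢0}} (begin
    n ! * L !                     ≤⟨ m≤m+n _ _ ⟩
    n ! * L ! + harmonic (n !) L  ≤⟨ bound ⟩
    length xs * n ! + harmonic (n !) n
      ≤⟨ +-mono-≤ (*-monoˡ-≤ (n !) (determines⇒length≤1 σ det xs xs! xs-hist))
                  (≤-trans (harmonic-mono (n !) n≤2^k) (harmonic-2^ (n !) k)) ⟩
    1 * n ! + suc k * n !  ≡⟨ *-distribʳ-+ (n !) 1 (suc k) ⟨
    (2 + k) * n !          ≡⟨ *-comm (2 + k) (n !) ⟩
    n ! * (2 + k)          ∎)
  where open ≤-Reasoning

-- With k = 2·4^L this says k + 2 < L!. At L = 10 it reads 2097155 ≤ 3628800, while L = 9 fails;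
-- from there on a step multiplies the right side by more than 4.
3+2*4^L≤L! : ∀ {L} → 10 ≤ L → 3 + 2 * 4 ^ L ≤ L !
3+2*4^L≤L! 10≤L = go (≤⇒≤′ 10≤L)
  where
  open ≤-Reasoning
  go : ∀ {L} → 10 ≤′ L → 3 + 2 * 4 ^ L ≤ L !
  go ≤′-refl = ≤ᵇ⇒≤ (3 + 2 * 4 ^ 10) (10 !) _
  go {suc L} (≤′-step 10≤L) = begin
    3 + 2 * (4 * 4 ^ L)      ≡⟨ cong (3 +_) (x∙yz≈y∙xz 2 4 (4 ^ L)) ⟩
    3 + 4 * (2 * 4 ^ L)      ≤⟨ +-monoˡ-≤ (4 * (2 * 4 ^ L)) (m≤m+n 3 9) ⟩
    4 * 3 + 4 * (2 * 4 ^ L)  ≡⟨ *-distribˡ-+ 4 3 _ ⟨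
    4 * (3 + 2 * 4 ^ L)      ≤⟨ *-mono-≤ (s≤s (≤-trans (m≤m+n 3 7) (≤′⇒≤ 10≤L))) (go 10≤L) ⟩
    suc L * L !              ∎

-- Natural numbers inside the rationals.

-- Spelled as in `fromℕ`, so that `fromℕ n` unfolds to the cuts at `ι n`.
ι : ℕ → ℚ
ι n = ℤ.+ n ℚ./ 1

-- Normalised fractions hide a gcd that is stuck on variables. Unnormalised ones reduce the facts
-- below to integer cross-multiplication.
toℚᵘ-/ : ∀ i n → toℚᵘ (i ℚ./ suc n) ℚᵘ.≃ ℚᵘ.mkℚᵘ i n
toℚᵘ-/ i n = ℚ.toℚᵘ-fromℚᵘ (ℚᵘ.mkℚᵘ i n)

ι-≤ : ∀ {m n} → m ≤ n → ι m ℚ.≤ ι n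
ι-≤ {m} {n} m≤n = ℚ.toℚᵘ-cancel-≤ (ℚᵘ.≤-respˡ-≃ (ℚᵘ.≃-sym (toℚᵘ-/ (ℤ.+ m) 0)) (ℚᵘ.≤-respʳ-≃ (ℚᵘ.≃-sym (toℚᵘ-/ (ℤ.+ n) 0))
  (ℚᵘ.*≤* (ℤ.*-monoʳ-≤-nonNeg (ℤ.+ 1) (ℤ.+≤+ m≤n)))))

ι-<⁻ : ∀ {m n} → ι m ℚ.< ι n → m < n
ι-<⁻ m<n = ≰⇒> λ n≤m → ℚ.<-irrefl refl (ℚ.<-≤-trans m<n (ι-≤ n≤m))

ι-+ : ∀ m n → ι (m + n) ≡ ι m ℚ.+ ι n
ι-+ m n = ℚ.toℚᵘ-injective (begin
  toℚᵘ (ι (m + n))                          ≈⟨ toℚᵘ-/ _ 0 ⟩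
  ℚᵘ.mkℚᵘ (ℤ.+ (m + n)) 0                   ≈⟨ ℚᵘ.*≡* (cong (ℤ._* ℤ.+ 1) (sym (cong₂ ℤ._+_ (ℤ.*-identityʳ (ℤ.+ m)) (ℤ.*-identityʳ (ℤ.+ n))))) ⟩
  ℚᵘ.mkℚᵘ (ℤ.+ m) 0 ℚᵘ.+ ℚᵘ.mkℚᵘ (ℤ.+ n) 0  ≈⟨ ℚᵘ.+-cong (toℚᵘ-/ (ℤ.+ m) 0) (toℚᵘ-/ (ℤ.+ n) 0) ⟨
  toℚᵘ (ι m) ℚᵘ.+ toℚᵘ (ι n)                ≈⟨ ℚ.toℚᵘ-homo-+ (ι m) (ι n) ⟨
  toℚᵘ (ι m ℚ.+ ι n)                        ∎)
  where open ℚᵘ.≃-Reasoning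

ι-* : ∀ m n → ι (m * n) ≡ ι m ℚ.* ι n
ι-* m n = ℚ.toℚᵘ-injective (begin
  toℚᵘ (ι (m * n))                          ≈⟨ toℚᵘ-/ _ 0 ⟩
  ℚᵘ.mkℚᵘ (ℤ.+ (m * n)) 0                   ≈⟨ ℚᵘ.*≡* (cong (ℤ._* ℤ.+ 1) (ℤ.pos-* m n)) ⟩
  ℚᵘ.mkℚᵘ (ℤ.+ m) 0 ℚᵘ.* ℚᵘ.mkℚᵘ (ℤ.+ n) 0  ≈⟨ ℚᵘ.*-cong (toℚᵘ-/ (ℤ.+ m) 0) (toℚᵘ-/ (ℤ.+ n) 0) ⟨
  toℚᵘ (ι m) ℚᵘ.* toℚᵘ (ι n)                ≈⟨ ℚ.toℚᵘ-homo-* (ι m) (ι n) ⟨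
  toℚᵘ (ι m ℚ.* ι n)                        ∎)
  where open ℚᵘ.≃-Reasoning

ι-^ : ∀ m n → ι (m ^ n) ≡ ι m ^ℚ n
ι-^ m zero    = refl
ι-^ m (suc n) = trans (ι-* m (m ^ n)) (cong (ι m ℚ.*_) (ι-^ m n))

ι-pos : ∀ n .{{_ : NonZero n}} → ℚ.Positive (ι n)
ι-pos (suc n) = ℚ.normalize-pos (suc n) 1

ι-inverse : ∀ n → ι (suc n) ℚ.* (ℤ.+ 1 ℚ./ suc n) ≡ 1ℚ
ι-inverse n = ℚ.toℚᵘ-injective (begin
  toℚᵘ (ι (suc n) ℚ.* (ℤ.+ 1 ℚ./ suc n))        ≈⟨ ℚ.toℚᵘ-homo-* (ι (suc n)) (ℤ.+ 1 ℚ./ suc n) ⟩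
  toℚᵘ (ι (suc n)) ℚᵘ.* toℚᵘ (ℤ.+ 1 ℚ./ suc n)  ≈⟨ ℚᵘ.*-cong (toℚᵘ-/ (ℤ.+ suc n) 0) (toℚᵘ-/ (ℤ.+ 1) n) ⟩
  ℚᵘ.mkℚᵘ (ℤ.+ suc n) 0 ℚᵘ.* ℚᵘ.mkℚᵘ (ℤ.+ 1) n  ≈⟨ ℚᵘ.*≡* (trans (ℤ.*-identityʳ _)
    (trans (ℤ.*-identityʳ _) (trans (cong ℤ.+_ (sym (+-identityʳ (suc n)))) (sym (ℤ.*-identityˡ _))))) ⟩
  ℚᵘ.1ℚᵘ                                     ∎)
  where open ℚᵘ.≃-Reasoning

-- Powers, and the crude bound e^U ≤ 4^U for Euler's limit.

^ℚ-nonNeg : ∀ {x} n → 0ℚ ℚ.≤ x → 0ℚ ℚ.≤ x ^ℚ n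
^ℚ-nonNeg     zero    0≤x = ℚ.<⇒≤ (ℚ.positive⁻¹ 1ℚ)
^ℚ-nonNeg {x} (suc n) 0≤x = subst (ℚ._≤ x ^ℚ suc n) (ℚ.*-zeroʳ x)
  (ℚ.*-monoˡ-≤-nonNeg x {{ℚ.nonNegative 0≤x}} (^ℚ-nonNeg n 0≤x))

^ℚ-monoˡ-≤ : ∀ {x y} n → 0ℚ ℚ.≤ x → x ℚ.≤ y → x ^ℚ n ℚ.≤ y ^ℚ n
^ℚ-monoˡ-≤         zero    0≤x x≤y = ℚ.≤-refl
^ℚ-monoˡ-≤ {x} {y} (suc n) 0≤x x≤y = begin
  x ℚ.* x ^ℚ n  ≤⟨ ℚ.*-monoˡ-≤-nonNeg x {{ℚ.nonNegative 0≤x}} (^ℚ-monoˡ-≤ n 0≤x x≤y) ⟩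
  x ℚ.* y ^ℚ n  ≤⟨ ℚ.*-monoʳ-≤-nonNeg (y ^ℚ n) {{ℚ.nonNegative (^ℚ-nonNeg n (ℚ.≤-trans 0≤x x≤y))}} x≤y ⟩
  y ℚ.* y ^ℚ n  ∎
  where open ℚ.≤-Reasoning

-- Bernoulli's inequality (1 − 1/(a+1))^j ≥ 1 − j/(a+1), cleared of denominators and of subtractions.
bernoulli : ∀ j b → let a = b + j in suc a ^ j * suc b ≤ a ^ j * suc a
bernoulli zero b = ≤-reflexive (cong (λ a → suc (a + 0)) (sym (+-identityʳ b)))
bernoulli (suc j) b = begin
  suc a * suc a ^ j * suc b      ≡⟨ solve 3 (λ x y z → x :* y :* z := y :* (x :* z)) refl (suc a) (suc a ^ j) (suc b) ⟩
  suc a ^ j * (suc a * suc b)    ≤⟨ *-monoʳ-≤ (suc a ^ j) a-step ⟩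
  suc a ^ j * (a * suc (suc b))  ≡⟨ solve 3 (λ x y z → x :* (y :* z) := y :* (x :* z)) refl (suc a ^ j) a (suc (suc b)) ⟩
  a * (suc a ^ j * suc (suc b))  ≤⟨ *-monoʳ-≤ a (subst (λ c → suc c ^ j * suc (suc b) ≤ c ^ j * suc c) (sym (+-suc b j)) (bernoulli j (suc b))) ⟩
  a * (a ^ j * suc a)            ≡⟨ *-assoc a _ _ ⟨
  a * a ^ j * suc a              ∎
  where
  open ≤-Reasoning
  open +-*-Solver
  a = b + suc j
  a-step : suc a * suc b ≤ a * suc (suc b)
  a-step = begin
    suc b + a * suc b  ≤⟨ +-monoˡ-≤ _ (subst (suc b ≤_) (sym (+-suc b j)) (s≤s (m≤m+n b j))) ⟩
    a + a * suc b      ≡⟨ *-suc a (suc b) ⟨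
    a * suc (suc b)    ∎

-- Bernoulli with j = b = r: (1 + 1/2r)^r ≤ (2r + 1)/(r + 1) ≤ 2. Squaring yields the constant 4
-- that replaces e.
[1+2r]^r≤2*[2r]^r : ∀ r → suc (r + r) ^ r ≤ 2 * (r + r) ^ r
[1+2r]^r≤2*[2r]^r r = *-cancelʳ-≤ _ _ (suc r) (begin
  suc a ^ r * suc r    ≤⟨ bernoulli r r ⟩
  a ^ r * suc a        ≤⟨ *-monoʳ-≤ (a ^ r) (n≤1+n (suc a)) ⟩
  a ^ r * suc (suc a)  ≡⟨ solve 2 (λ x r → x :* (con 2 :+ (r :+ r)) := con 2 :* x :* (con 1 :+ r)) refl (a ^ r) r ⟩
  2 * a ^ r * suc r    ∎)
  where
  open ≤-Reasoning
  open +-*-Solver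
  a = r + r

^-distribʳ-* : ∀ x y n → (x * y) ^ n ≡ x ^ n * y ^ n
^-distribʳ-* x y zero    = refl
^-distribʳ-* x y (suc n) =
  trans (cong (x * y *_) (^-distribʳ-* x y n)) ([m*n]*[o*p]≡[m*o]*[n*p] x y _ _)

[1+2r]^[U*2r]≤4^U*[2r]^[U*2r] : ∀ U r → let a = r + r in suc a ^ (U * a) ≤ 4 ^ U * a ^ (U * a)
[1+2r]^[U*2r]≤4^U*[2r]^[U*2r] U r = begin
  suc a ^ (U * a)                ≡⟨ split (suc a) ⟩
  (suc a ^ r * suc a ^ r) ^ U    ≤⟨ ^-monoˡ-≤ U (*-mono-≤ ([1+2r]^r≤2*[2r]^r r) ([1+2r]^r≤2*[2r]^r r)) ⟩
  (2 * a ^ r * (2 * a ^ r)) ^ U  ≡⟨ cong (_^ U) (solve 1 (λ x → con 2 :* x :* (con 2 :* x) := con 4 :* (x :* x)) refl (a ^ r)) ⟩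
  (4 * (a ^ r * a ^ r)) ^ U      ≡⟨ ^-distribʳ-* 4 _ U ⟩
  4 ^ U * (a ^ r * a ^ r) ^ U    ≡⟨ cong (4 ^ U *_) (split a) ⟨
  4 ^ U * a ^ (U * a)            ∎
  where
  open ≤-Reasoning
  open +-*-Solver
  a = r + r
  split : ∀ x → x ^ (U * a) ≡ (x ^ r * x ^ r) ^ U
  split x = trans (cong (x ^_) (*-comm U a))
    (trans (sym (^-*-assoc x a U)) (cong (_^ U) (^-distribˡ-+-* x r r)))

-- The denominator is at least 1, so -q is at most the absolute value of the numerator.
0≤q+ι∣↥q∣ : ∀ q → 0ℚ ℚ.≤ q ℚ.+ ι ℤ.∣ ℚ.↥ q ∣
0≤q+ι∣↥q∣ q@(ℚ.mkℚ (ℤ.+ n) _ _) =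
  ℚ.+-mono-≤ (ℚ.nonNegative⁻¹ q) (ι-≤ {0} {n} z≤n)
0≤q+ι∣↥q∣ q@(ℚ.mkℚ (ℤ.-[1+ n ]) d _) =
  subst (ℚ._≤ q ℚ.+ ι (suc n)) (ℚ.+-inverseʳ q) (ℚ.+-monoʳ-≤ q (ℚ.toℚᵘ-cancel-≤ {ℚ.- q} {ι (suc n)} (
    ℚᵘ.≤-respʳ-≃ (ℚᵘ.≃-sym (toℚᵘ-/ (ℤ.+ suc n) 0))
      (ℚᵘ.*≤* (ℤ.*-monoˡ-≤-nonNeg (ℤ.+ suc n) (ℤ.+≤+ (s≤s (z≤n {d}))))))))

module _ (q : ℚ) (k : ℕ) where
  private iv = ℤ.+ 1 ℚ./ suc k

  k*[1+q/k]≡q+k : ι (suc k) ℚ.* (1ℚ ℚ.+ q ℚ.* iv) ≡ q ℚ.+ ι (suc k)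
  k*[1+q/k]≡q+k = begin
    ι (suc k) ℚ.* (1ℚ ℚ.+ q ℚ.* iv)                ≡⟨ ℚ.*-distribˡ-+ (ι (suc k)) 1ℚ (q ℚ.* iv) ⟩
    ι (suc k) ℚ.* 1ℚ ℚ.+ ι (suc k) ℚ.* (q ℚ.* iv)  ≡⟨ cong₂ ℚ._+_ (ℚ.*-identityʳ (ι (suc k))) (ℚ-x∙yz≈y∙xz (ι (suc k)) q iv) ⟩
    ι (suc k) ℚ.+ q ℚ.* (ι (suc k) ℚ.* iv)         ≡⟨ cong (λ z → ι (suc k) ℚ.+ q ℚ.* z) (ι-inverse k) ⟩
    ι (suc k) ℚ.+ q ℚ.* 1ℚ                         ≡⟨ cong (ι (suc k) ℚ.+_) (ℚ.*-identityʳ q) ⟩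
    ι (suc k) ℚ.+ q                                ≡⟨ ℚ.+-comm _ q ⟩
    q ℚ.+ ι (suc k)                                ∎
    where open ≡-Reasoning

  -- Since q may be negative, the base of Euler's power is nonnegative only for large k;
  -- monotonicity of powers requires this.
  1+q/k-nonNeg : ℤ.∣ ℚ.↥ q ∣ ≤ suc k → 0ℚ ℚ.≤ 1ℚ ℚ.+ q ℚ.* iv
  1+q/k-nonNeg ∣↥q∣≤ = ℚ.*-cancelˡ-≤-pos (ι (suc k)) {{ι-pos (suc k)}} (begin
    ι (suc k) ℚ.* 0ℚ                 ≡⟨ ℚ.*-zeroʳ (ι (suc k)) ⟩
    0ℚ                               ≤⟨ 0≤q+ι∣↥q∣ q ⟩
    q ℚ.+ ι ℤ.∣ ℚ.↥ q ∣              ≤⟨ ℚ.+-monoʳ-≤ q (ι-≤ ∣↥q∣≤) ⟩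
    q ℚ.+ ι (suc k)                  ≡⟨ k*[1+q/k]≡q+k ⟨
    ι (suc k) ℚ.* (1ℚ ℚ.+ q ℚ.* iv)  ∎)
    where open ℚ.≤-Reasoning

[1+U/k]*a : ∀ U a k → U * a ≡ suc k →
  (1ℚ ℚ.+ ι U ℚ.* (ℤ.+ 1 ℚ./ suc k)) ℚ.* ι a ≡ ι (suc a)
[1+U/k]*a U a k Ua≡ = begin
  (1ℚ ℚ.+ ι U ℚ.* iv) ℚ.* ι a        ≡⟨ ℚ.*-distribʳ-+ (ι a) 1ℚ (ι U ℚ.* iv) ⟩
  1ℚ ℚ.* ι a ℚ.+ ι U ℚ.* iv ℚ.* ι a  ≡⟨ cong₂ ℚ._+_ (ℚ.*-identityˡ (ι a)) (ℚ-xy∙z≈xz∙y (ι U) iv (ι a)) ⟩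
  ι a ℚ.+ ι U ℚ.* ι a ℚ.* iv         ≡⟨ cong (λ z → ι a ℚ.+ z ℚ.* iv) (trans (sym (ι-* U a)) (cong ι Ua≡)) ⟩
  ι a ℚ.+ ι (suc k) ℚ.* iv           ≡⟨ cong (ι a ℚ.+_) (ι-inverse k) ⟩
  ι a ℚ.+ ι 1                        ≡⟨ ℚ.+-comm (ι a) (ι 1) ⟩
  ι 1 ℚ.+ ι a                        ≡⟨ ι-+ 1 a ⟨
  ι (suc a)                          ∎
  where
  open ≡-Reasoning
  iv = ℤ.+ 1 ℚ./ suc k

-- With a = 2r and k + 1 = Ua, the base is (a + 1)/a, so multiplying by a^(k + 1) leaves an
-- inequality between integers.
[1+U/k]^k≤4^U : ∀ U r .{{_ : NonZero r}} k → U * (r + r) ≡ suc k →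
  (1ℚ ℚ.+ ι U ℚ.* (ℤ.+ 1 ℚ./ suc k)) ^ℚ suc k ℚ.≤ ι (4 ^ U)
[1+U/k]^k≤4^U U r@(suc _) k Ua≡ = ℚ.*-cancelʳ-≤-pos (ι (a ^ suc k)) {{ι-pos _ {{m^n≢0 a (suc k)}}}} (begin
  y ^ℚ suc k ℚ.* ι (a ^ suc k)  ≡⟨ cong (y ^ℚ suc k ℚ.*_) (ι-^ a (suc k)) ⟩
  y ^ℚ suc k ℚ.* ι a ^ℚ suc k   ≡⟨ ^ℚ-distrib-* y (ι a) (suc k) ⟨
  (y ℚ.* ι a) ^ℚ suc k          ≡⟨ cong (_^ℚ suc k) ([1+U/k]*a U a k Ua≡) ⟩
  ι (suc a) ^ℚ suc k            ≡⟨ ι-^ (suc a) (suc k) ⟨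
  ι (suc a ^ suc k)             ≤⟨ ι-≤ (subst (λ K → suc a ^ K ≤ 4 ^ U * a ^ K) Ua≡ ([1+2r]^[U*2r]≤4^U*[2r]^[U*2r] U r)) ⟩
  ι (4 ^ U * a ^ suc k)         ≡⟨ ι-* (4 ^ U) (a ^ suc k) ⟩
  ι (4 ^ U) ℚ.* ι (a ^ suc k)   ∎)
  where
  open ℚ.≤-Reasoning
  a = r + r
  y = 1ℚ ℚ.+ ι U ℚ.* (ℤ.+ 1 ℚ./ suc k)

-- The lower cut of a limit bounds all late terms from below, so a single late term that is at most
-- 4^U suffices.
exp-Lower⇒<4^U : ∀ {q v} U .{{_ : NonZero U}} → q ℚ.≤ ι U → Lower (exp q) v → v ℚ.< ι (4 ^ U)
exp-Lower⇒<4^U {q} {v} U@(suc U-1) q≤U (w , v<w , N , w≤) = begin-strict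
  v                                          <⟨ v<w ⟩
  w                                          ≤⟨ w≤ k N≤k ⟩
  (1ℚ ℚ.+ q ℚ.* (ℤ.+ 1 ℚ./ suc k)) ^ℚ suc k  ≤⟨ ^ℚ-monoˡ-≤ (suc k) (1+q/k-nonNeg q k (m≤n⇒m≤1+n d≤k))
                                                       (ℚ.+-monoʳ-≤ 1ℚ (ℚ.*-monoʳ-≤-nonNeg _ {{ℚ.normalize-nonNeg 1 (suc k)}} q≤U)) ⟩
  (1ℚ ℚ.+ ι U ℚ.* (ℤ.+ 1 ℚ./ suc k)) ^ℚ suc k  ≤⟨ [1+U/k]^k≤4^U U (suc (N + d)) k refl ⟩
  ι (4 ^ U)                                    ∎
  where
  open ℚ.≤-Reasoning
  -- suc k is U * 2r for r = N + d + 1, beyond N and d, and (1 + 1/2r)^r ≤ 2.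
  d = ℤ.∣ ℚ.↥ q ∣
  k = N + d + suc (N + d) + U-1 * (suc (N + d) + suc (N + d))
  N+d≤k : N + d ≤ k
  N+d≤k = ≤-trans (m≤m+n (N + d) _) (m≤m+n _ _)
  N≤k : N ≤ k
  N≤k = ≤-trans (m≤m+n N d) N+d≤k
  d≤k : d ≤ k
  d≤k = ≤-trans (m≤n+m d N) N+d≤k

-- From the iterated logarithm to the theorem.

-- Unfolding the two logarithms gives rationals u < e^s and v < e^u with n < v, so the bound on exp
-- applies twice: u < 4^L, then v < 4^(4^L).
loglog-Upper⇒<4^4^L : ∀ {n s} L .{{_ : NonZero L}} → s ℚ.≤ ι L →
  Upper (log (log (fromℕ n))) s → n < 4 ^ 4 ^ L
loglog-Upper⇒<4^4^L L s≤L (u , (v , n<v , v<eᵘ) , u<eˢ) =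
  ι-<⁻ (ℚ.<-trans n<v (exp-Lower⇒<4^U (4 ^ L) {{m^n≢0 4 L}} (ℚ.<⇒≤ (exp-Lower⇒<4^U L s≤L u<eˢ)) v<eᵘ))

m<r-s⇒s≤n∸m : ∀ {m n r s} → ι m ℚ.< r ℚ.- s → r ℚ.< ι n → s ℚ.≤ ι (n ∸ m)
m<r-s⇒s≤n∸m {m} {n} {r} {s} m<r-s r<n = ℚ.≮⇒≥ λ n∸m<s → ℚ.<-irrefl refl (begin-strict
  r                    <⟨ r<n ⟩
  -- Subtraction is truncated, but n ≤ m + (n ∸ m) also holds when m exceeds n.
  ι n                  ≤⟨ ι-≤ (m≤n+m∸n n m) ⟩
  ι (m + (n ∸ m))      ≡⟨ ι-+ m (n ∸ m) ⟩
  ι m ℚ.+ ι (n ∸ m)    <⟨ ℚ.+-mono-< m<r-s n∸m<s ⟩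
  r ℚ.- s ℚ.+ s        ≡⟨ ℚ.+-assoc r (ℚ.- s) s ⟩
  r ℚ.+ (ℚ.- s ℚ.+ s)  ≡⟨ cong (r ℚ.+_) (ℚ.+-inverseˡ s) ⟩
  r ℚ.+ 0ℚ             ≡⟨ ℚ.+-identityʳ r ⟩
  r                    ∎)
  where open ℚ.≤-Reasoning

-- A variable c in place of 10 keeps the numeral 4 ^ 4 ^ 10 from being unfolded.
module _ {c : ℕ} .{{_ : NonZero c}} (large : ∀ {L} → c ≤ L → 3 + 2 * 4 ^ L ≤ L !) where

  -- A failure of `≤ᴿ` supplies a rational strictly between m and n - log log n, so log log n lies
  -- below the gap L = n ∸ m. Both small and large gaps are contradictory.
  n-loglogn≤ : ∀ {n} → 4 ^ 4 ^ c ≤ n → (σ : Strategy n) (m : ℕ) → DeterminesWithin σ m →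
    fromℕ n -ᴿ log (log (fromℕ n)) ≤ᴿ fromℕ m
  n-loglogn≤ {n} n₀≤n σ m det (q , m<q , r , s , r<n , loglogn<s , q≡r-s)
    with m<r-s⇒s≤n∸m {m} {n} (subst (ι m ℚ.<_) q≡r-s m<q) r<n | ≤-total c (n ∸ m)
  -- A gap of at most c would force n < 4^(4^c).
  ... | s≤L | inj₂ L≤c =
    <⇒≱ (loglog-Upper⇒<4^4^L c (ℚ.≤-trans s≤L (ι-≤ L≤c)) loglogn<s) n₀≤n
  -- Here n < 4^(4^L) = 2^(2·4^L), so L! ≤ 2 + 2·4^L, against `large`.
  ... | s≤L | inj₁ c≤L = <⇒≱ (large c≤L)
      (determines⇒L!≤k+2 σ L (2 * 4 ^ L) (m+[n∸m]≡n (<⇒≤ m<n)) n≤2^k det)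
    where
    L = n ∸ m
    instance
      L≢0 : NonZero L
      L≢0 = >-nonZero (<-≤-trans (>-nonZero⁻¹ c) c≤L)
    m<n : m < n
    m<n = m∸n≢0⇒n<m (≢-nonZero⁻¹ L)
    n≤2^k : n ≤ 2 ^ (2 * 4 ^ L)
    n≤2^k = subst (n ≤_) (^-*-assoc 2 2 (4 ^ L)) (<⇒≤ (loglog-Upper⇒<4^4^L L s≤L loglogn<s))

theorem1 : ∃[ n₀ ] ∀ (n : ℕ) → n₀ ≤ n →
    (∀ (σ : Strategy n) (m : ℕ) → DeterminesWithin σ m →
    fromℕ n -ᴿ log (log (fromℕ n)) ≤ᴿ fromℕ m)
    × (∀ (m : ℕ) → IsOptimal n m →
    fromℕ n -ᴿ log (log (fromℕ n)) ≤ᴿ fromℕ m)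
-- The 10 is the threshold of the factorial inequality. An optimal m comes with a strategy attaining
-- it, which reduces the second half to the first.
theorem1 = 4 ^ 4 ^ 10 , λ n n₀≤n →
  n-loglogn≤ 3+2*4^L≤L! n₀≤n ,
  λ { m ((σ , det) , _) → n-loglogn≤ 3+2*4^L≤L! n₀≤n σ m det }
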